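{- Let $\mathcal{F}(G)$ be the free $2$-coloured operad on the eight generators $g_{xyz}$, $x,y,z\in\{a,b\}$, coloured as below, and let $\equiv$ be the smallest coloured operad congruence of $\mathcal{F}(G)$ identifying, within each of the following sixteen lines, all four displayed trees (here $g\circ_i h$ denotes $\mathrm{Cor}(g)\circ_i\mathrm{Cor}(h)$): (1) $g_{bbb}\circ_2 g_{bab}$, $g_{bbb}\circ_1 g_{bab}$, $g_{abb}\circ_1 g_{bbb}$, $g_{bba}\circ_2 g_{bbb}$; (2) $g_{bbb}\circ_2 g_{aab}$, $g_{bbb}\circ_1 g_{baa}$, $g_{abb}\circ_1 g_{bba}$, $g_{bba}\circ_2 g_{abb}$; (3) $g_{bbb}\circ_2 g_{aaa}$, $g_{aba}\circ_1 g_{bba}$, $g_{bba}\circ_2 g_{aba}$, $g_{bba}\circ_1 g_{baa}$; (4) $g_{bbb}\circ_2 g_{baa}$, $g_{aba}\circ_1 g_{bbb}$, $g_{bba}\circ_2 g_{bba}$, $g_{bba}\circ_1 g_{bab}$; (5) $g_{bbb}\circ_1 g_{aab}$, $g_{abb}\circ_2 g_{bab}$, $g_{abb}\circ_1 g_{abb}$, $g_{aba}\circ_2 g_{bbb}$; (6) $g_{bbb}\circ_1 g_{aaa}$, $g_{abb}\circ_2 g_{aab}$, $g_{abb}\circ_1 g_{aba}$, $g_{aba}\circ_2 g_{abb}$; (7) $g_{abb}\circ_2 g_{aaa}$, $g_{aba}\circ_2 g_{aba}$, $g_{aba}\circ_1 g_{aba}$, $g_{bba}\circ_1 g_{aaa}$;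 (8) $g_{abb}\circ_2 g_{baa}$, $g_{aba}\circ_2 g_{bba}$, $g_{aba}\circ_1 g_{abb}$, $g_{bba}\circ_1 g_{aab}$; (9) $g_{bab}\circ_2 g_{bab}$, $g_{bab}\circ_1 g_{bab}$, $g_{aab}\circ_1 g_{bbb}$, $g_{baa}\circ_2 g_{bbb}$; (10) $g_{bab}\circ_2 g_{aab}$, $g_{bab}\circ_1 g_{baa}$, $g_{aab}\circ_1 g_{bba}$, $g_{baa}\circ_2 g_{abb}$; (11) $g_{bab}\circ_2 g_{aaa}$, $g_{aaa}\circ_1 g_{bba}$, $g_{baa}\circ_2 g_{aba}$, $g_{baa}\circ_1 g_{baa}$; (12) $g_{bab}\circ_2 g_{baa}$, $g_{aaa}\circ_1 g_{bbb}$, $g_{baa}\circ_2 g_{bba}$, $g_{baa}\circ_1 g_{bab}$; (13) $g_{bab}\circ_1 g_{aab}$, $g_{aab}\circ_2 g_{bab}$, $g_{aab}\circ_1 g_{abb}$, $g_{aaa}\circ_2 g_{bbb}$; (14) $g_{bab}\circ_1 g_{aaa}$, $g_{aab}\circ_2 g_{aab}$, $g_{aab}\circ_1 g_{aba}$, $g_{aaa}\circ_2 g_{abb}$; (15) $g_{aab}\circ_2 g_{aaa}$, $g_{aaa}\circ_2 g_{aba}$, $g_{aaa}\circ_1 g_{aba}$, $g_{baa}\circ_1 g_{aaa}$; (16) $g_{aab}\circ_2 g_{baa}$, $g_{aaa}\circ_2 g_{bba}$, $g_{aaa}\circ_1 g_{abb}$, $g_{baa}\circ_1 g_{aab}$.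 Then the morphism of coloured operads $\mathcal{F}(G)\to\mathrm{Bulle}$ sending $g_{xyz}$ to $\beta_{xyz}$ induces an isomorphism $\mathcal{F}(G)/_{\equiv}\cong\mathrm{Bulle}$; that is, $\mathrm{Bulle}$ admits the presentation with generators $\beta_{xyz}$ and the relations above.
   Context: $\mathrm{Bulle}$ is the $2$-coloured (non-symmetric, set-theoretic) operad whose elements of arity $n\ge2$ are the bubbles, i.e. pairs $(c,w)$ with $c\in\{1,2\}$ (output colour) and $w=w_1\cdots w_n\in\{1,2\}^n$ ($i$-th input colour $w_i$), and whose elements of arity $1$ are units $\mathbb{1}_1,\mathbb{1}_2$ ($\mathbb{1}_c$ has output and input colour $c$). The composition $(c,u)\circ_i(d,v)$ is defined iff $u_i=d$ and then equals $(c,u_1\cdots u_{i-1}vu_{i+1}\cdots u_n)$. Geometrically, a bubble is a polygon with vertices $1,\dots,n+1$ whose edges $(i,i+1)$ and base $(1,n+1)$ are blue or uncoloured, with no coloured diagonals: $c=1$ iff the base is blue, and $w_i=2$ iff the $i$-th edge is blue. For $x,y,z\in\{a,b\}$ ($a$ meaning blue, $b$ meaning uncoloured), $\beta_{xyz}$ is the bubble of arity $2$ whose first edge has colour $x$, whose base has colour $y$, and whose second edge has colour $z$. In pair notation, $\beta_{xyz}=(c,w_1w_2)$ with $c=1$ iff $y=a$, $w_1=2$ iff $x=a$, $w_2=2$ iff $z=a$. The generator $g_{xyz}$ is a formal binary generator with the same output and input colours as $\beta_{xyz}$. The free $2$-coloured operad $\mathcal{F}(G)$ consists of planar rooted trees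 with binary internal nodes labelled by generators such that, whenever a node labelled $h$ is the $i$-th child of a node labelled $g$, the $i$-th input colour of $g$ equals the output colour of $h$ (together with the two units). Its composition grafts the root of one tree onto a leaf of another of matching colour. $\mathrm{Cor}(g)$ denotes the one-node tree labelled $g$. -}

module Defs where

open import Data.Nat using (ℕ; zero; suc; _+_; _≤_; z≤n; s≤s)
open import Data.Nat.Properties using (≤-trans; ≤-reflexive; +-monoˡ-≤)
open import Data.Fin using (Fin; zero; suc)
open import Data.List using (List; []; _∷_; _++_; length; lookup; [_])
open import Data.List.Properties using (length-++; ++-identityʳ)
open import Data.List.Membership.Propositional using (_∈_)
open import Data.Product using (Σ; _,_; proj₁)
open import Relation.Binary.PropositionalEquality using (_≡_; refl; sym; cong; subst)

data Colour : Set where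
  c1 c2 : Colour

-- a = blue, b = uncoloured
data AB : Set where
  a b : AB

-- output colour from the base colour y : c = 1 iff y = a
outAB : AB → Colour
outAB a = c1
outAB b = c2

-- input colour from an edge colour x : w_i = 2 iff x = a
inAB : AB → Colour
inAB a = c2
inAB b = c1

data Gen : Set where
  g : AB → AB → AB → Gen

out : Gen → Colour
out (g x y z) = outAB y

in₁ : Gen → Colour
in₁ (g x y z) = inAB x

in₂ : Gen → Colour
in₂ (g x y z) = inAB z

-- The coloured operad Bulle.  Bulle c w = elements with output colour c
-- and list of input colours w.

data Bulle : Colour → List Colour → Set where
  unit   : (c : Colour) → Bulle c [ c ]
  bubble : (c : Colour) (w : List Colour) → 2 ≤ length w → Bulle c w

replace : {A : Set} (w : List A) → Fin (length w) → List A → List A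
replace (x ∷ w) zero    v = v ++ w
replace (x ∷ w) (suc i) v = x ∷ replace w i v

replace-length : {A : Set} (w : List A) (i : Fin (length w)) (v : List A) →
                 1 ≤ length v → length w ≤ length (replace w i v)
replace-length (x ∷ w) zero v p =
  ≤-trans (+-monoˡ-≤ (length w) p) (≤-reflexive (sym (length-++ v)))
replace-length (x ∷ w) (suc i) v p = s≤s (replace-length w i v p)

bulle-arity : ∀ {c v} → Bulle c v → 1 ≤ length v
bulle-arity (unit c)       = s≤s z≤n
bulle-arity (bubble c w p) = ≤-trans (s≤s z≤n) p

_∘⟨_⟩_ : ∀ {c w v} → Bulle c w → (i : Fin (length w)) →
         Bulle (lookup w i) v → Bulle c (replace w i v)
_∘⟨_⟩_ {v = v} (unit c) zero y = subst (Bulle c) (sym (++-identityʳ v)) y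
_∘⟨_⟩_ {v = v} (bubble c w p) i y =
  bubble c (replace w i v) (≤-trans p (replace-length w i v (bulle-arity y)))

β : (h : Gen) → Bulle (out h) (in₁ h ∷ in₂ h ∷ [])
β h = bubble (out h) (in₁ h ∷ in₂ h ∷ []) (s≤s (s≤s z≤n))

-- The free 2-coloured operad F(G): planar binary trees with nodes labelled
-- by generators, colour-compatible, indexed by output colour; leaf c is the
-- unit 1_c (and a leaf of colour c elsewhere).

data Tree : Colour → Set where
  leaf : (c : Colour) → Tree c
  node : (h : Gen) → Tree (in₁ h) → Tree (in₂ h) → Tree (out h)

leaves : ∀ {c} → Tree c → List Colour
leaves (leaf c)     = [ c ]
leaves (node h l r) = leaves l ++ leaves r

FG : Colour → List Colour → Set
FG c w = Σ (Tree c) (λ t → leaves t ≡ w)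

Cor : (h : Gen) → Tree (out h)
Cor h = node h (leaf (in₁ h)) (leaf (in₂ h))

data Pos : ∀ {c} → Tree c → Colour → Set where
  here  : ∀ {c} → Pos (leaf c) c
  left  : ∀ {h d} {l : Tree (in₁ h)} {r : Tree (in₂ h)} → Pos l d → Pos (node h l r) d
  right : ∀ {h d} {l : Tree (in₁ h)} {r : Tree (in₂ h)} → Pos r d → Pos (node h l r) d

posIndex : ∀ {c d} {t : Tree c} → Pos t d → ℕ
posIndex here               = zero
posIndex (left p)           = posIndex p
posIndex (right {l = l} p)  = length (leaves l) + posIndex p

graft : ∀ {c d} (t : Tree c) → Pos t d → Tree d → Tree c
graft (leaf c)     here      s = s
graft (node h l r) (left p)  s = node h (graft l p s) r
graft (node h l r) (right p) s = node h l (graft r p s)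

_∘₁_ : (h : Gen) → Tree (in₁ h) → Tree (out h)
h ∘₁ s = graft (Cor h) (left here) s

_∘₂_ : (h : Gen) → Tree (in₂ h) → Tree (out h)
h ∘₂ s = graft (Cor h) (right here) s

data LineId : Set where
  L1 L2 L3 L4 L5 L6 L7 L8 L9 L10 L11 L12 L13 L14 L15 L16 : LineId

lineOut : LineId → Colour
lineOut L1  = c2
lineOut L2  = c2
lineOut L3  = c2
lineOut L4  = c2
lineOut L5  = c2
lineOut L6  = c2
lineOut L7  = c2
lineOut L8  = c2
lineOut L9  = c1
lineOut L10 = c1
lineOut L11 = c1
lineOut L12 = c1
lineOut L13 = c1
lineOut L14 = c1
lineOut L15 = c1
lineOut L16 = c1

line : (k : LineId) → List (Tree (lineOut k))
line L1  = g b b b ∘₂ Cor (g b a b) ∷ g b b b ∘₁ Cor (g b a b) ∷ g a b b ∘₁ Cor (g b b b) ∷ g b b a ∘₂ Cor (g b b b) ∷ []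
line L2  = g b b b ∘₂ Cor (g a a b) ∷ g b b b ∘₁ Cor (g b a a) ∷ g a b b ∘₁ Cor (g b b a) ∷ g b b a ∘₂ Cor (g a b b) ∷ []
line L3  = g b b b ∘₂ Cor (g a a a) ∷ g a b a ∘₁ Cor (g b b a) ∷ g b b a ∘₂ Cor (g a b a) ∷ g b b a ∘₁ Cor (g b a a) ∷ []
line L4  = g b b b ∘₂ Cor (g b a a) ∷ g a b a ∘₁ Cor (g b b b) ∷ g b b a ∘₂ Cor (g b b a) ∷ g b b a ∘₁ Cor (g b a b) ∷ []
line L5  = g b b b ∘₁ Cor (g a a b) ∷ g a b b ∘₂ Cor (g b a b) ∷ g a b b ∘₁ Cor (g a b b) ∷ g a b a ∘₂ Cor (g b b b) ∷ []
line L6  = g b b b ∘₁ Cor (g a a a) ∷ g a b b ∘₂ Cor (g a a b) ∷ g a b b ∘₁ Cor (g a b a) ∷ g a b a ∘₂ Cor (g a b b) ∷ []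
line L7  = g a b b ∘₂ Cor (g a a a) ∷ g a b a ∘₂ Cor (g a b a) ∷ g a b a ∘₁ Cor (g a b a) ∷ g b b a ∘₁ Cor (g a a a) ∷ []
line L8  = g a b b ∘₂ Cor (g b a a) ∷ g a b a ∘₂ Cor (g b b a) ∷ g a b a ∘₁ Cor (g a b b) ∷ g b b a ∘₁ Cor (g a a b) ∷ []
line L9  = g b a b ∘₂ Cor (g b a b) ∷ g b a b ∘₁ Cor (g b a b) ∷ g a a b ∘₁ Cor (g b b b) ∷ g b a a ∘₂ Cor (g b b b) ∷ []
line L10 = g b a b ∘₂ Cor (g a a b) ∷ g b a b ∘₁ Cor (g b a a) ∷ g a a b ∘₁ Cor (g b b a) ∷ g b a a ∘₂ Cor (g a b b) ∷ []
line L11 = g b a b ∘₂ Cor (g a a a) ∷ g a a a ∘₁ Cor (g b b a) ∷ g b a a ∘₂ Cor (g a b a) ∷ g b a a ∘₁ Cor (g b a a) ∷ []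
line L12 = g b a b ∘₂ Cor (g b a a) ∷ g a a a ∘₁ Cor (g b b b) ∷ g b a a ∘₂ Cor (g b b a) ∷ g b a a ∘₁ Cor (g b a b) ∷ []
line L13 = g b a b ∘₁ Cor (g a a b) ∷ g a a b ∘₂ Cor (g b a b) ∷ g a a b ∘₁ Cor (g a b b) ∷ g a a a ∘₂ Cor (g b b b) ∷ []
line L14 = g b a b ∘₁ Cor (g a a a) ∷ g a a b ∘₂ Cor (g a a b) ∷ g a a b ∘₁ Cor (g a b a) ∷ g a a a ∘₂ Cor (g a b b) ∷ []
line L15 = g a a b ∘₂ Cor (g a a a) ∷ g a a a ∘₂ Cor (g a b a) ∷ g a a a ∘₁ Cor (g a b a) ∷ g b a a ∘₁ Cor (g a a a) ∷ []
line L16 = g a a b ∘₂ Cor (g b a a) ∷ g a a a ∘₂ Cor (g b b a) ∷ g a a a ∘₁ Cor (g a b b) ∷ g b a a ∘₁ Cor (g a a b) ∷ []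

data Ax : ∀ {c} → Tree c → Tree c → Set where
  ax : (k : LineId) {t t' : Tree (lineOut k)} → t ∈ line k → t' ∈ line k → Ax t t'

infix 4 _≈_
data _≈_ : ∀ {c} → Tree c → Tree c → Set where
  ≈-ax    : ∀ {c} {t t' : Tree c} → Ax t t' → t ≈ t'
  ≈-refl  : ∀ {c} {t : Tree c} → t ≈ t
  ≈-sym   : ∀ {c} {t t' : Tree c} → t ≈ t' → t' ≈ t
  ≈-trans : ∀ {c} {t t' t'' : Tree c} → t ≈ t' → t' ≈ t'' → t ≈ t''
  ≈-comp  : ∀ {c d} {t t' : Tree c} {s s' : Tree d}
            (p : Pos t d) (p' : Pos t' d) → posIndex p ≡ posIndex p' →
            t ≈ t' → s ≈ s' → graft t p s ≈ graft t' p' s'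

eval : ∀ {c} (t : Tree c) → Bulle c (leaves t)
eval (leaf c)     = unit c
eval (node h l r) =
  subst (Bulle (out h)) (cong (leaves l ++_) (++-identityʳ (leaves r)))
        ((β h ∘⟨ suc zero ⟩ eval r) ∘⟨ zero ⟩ eval l)

evalFG : ∀ {c w} → FG c w → Bulle c w
evalFG {c} (t , e) = subst (Bulle c) e (eval t)

{-# OPTIONS --safe #-}
-- Every space Bulle c w has at most one element, so the claim is that F(G)
-- has a tree over each bubble and that trees with the same output and the
-- same leaves are congruent.  Each of the sixteen lines consists of all four
-- three-leaf trees with a given output and given inputs: the inner node may be
-- on the left or on the right, and the middle edge may be blue or uncoloured.
-- Hence nodes can be rotated to the right and the middle edge made blue, which
-- brings every tree to a right comb determined by its leaves.
module Submission where

open import Defs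
open import Data.Fin using (Fin)
open import Data.Fin.Patterns using (0F; 1F; 2F; 3F)
open import Data.List using (List; []; _∷_; length; lookup)
open import Data.List.Membership.Propositional.Properties using (∈-lookup)
open import Data.List.Properties using (++-assoc)
open import Data.Nat using (_≤_; s≤s; z≤n)
open import Data.Nat.Properties using (≤-irrelevant)
open import Data.Product using (Σ; _×_; proj₁; _,_; ∃-syntax)
open import Data.Sum using (_⊎_; inj₁; inj₂)
open import Relation.Binary.PropositionalEquality using (_≡_; refl; cong; cong₂; subst; sym)

-- Arity separates units from bubbles, and proofs of `2 ≤ length w` are unique.
Bulle-irrelevant : ∀ {c w} (p q : Bulle c w) → p ≡ q
Bulle-irrelevant (unit c)       (unit .c)         = refl
Bulle-irrelevant (unit c)       (bubble .c _ (s≤s ()))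
Bulle-irrelevant (bubble c _ (s≤s ())) (unit .c)
Bulle-irrelevant (bubble c w p) (bubble .c .w q)  = cong (bubble c w) (≤-irrelevant p q)

-- A node is `Cor h` with both leaves grafted. Filling the right leaf first makes both index
-- equations hold by `refl`; the other order would need `l` and `l′` to have equally many leaves.
node-cong : ∀ h {l l′ r r′} → l ≈ l′ → r ≈ r′ → node h l r ≈ node h l′ r′
node-cong h l≈l′ r≈r′ =
  ≈-comp (left here) (left here) refl
    (≈-comp {t = Cor h} {t' = Cor h} (right here) (right here) refl ≈-refl r≈r′)
    l≈l′

-- The index a or b is the colour of the middle edge as an input of the outer
-- node; as the base of the inner node it is labelled the other way round,
-- because in Bulle the output colour 1 composes with the input colour 1.
module _ (x k m y : AB) (A : Tree (inAB x)) (B : Tree (inAB k)) (C : Tree (inAB m)) where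

  rightᵃ rightᵇ leftᵃ leftᵇ : Tree (outAB y)
  rightᵃ = node (g x y a) A (node (g k b m) B C)
  rightᵇ = node (g x y b) A (node (g k a m) B C)
  leftᵃ  = node (g a y m) (node (g x b k) A B) C
  leftᵇ  = node (g b y m) (node (g x a k) A B) C

AllCongruent : (x k m y : AB) → Tree (inAB x) → Tree (inAB k) → Tree (inAB m) → Set
AllCongruent x k m y A B C =
    (rightᵇ x k m y A B C ≈ rightᵃ x k m y A B C)
  × (leftᵇ  x k m y A B C ≈ rightᵃ x k m y A B C)
  × (leftᵃ  x k m y A B C ≈ rightᵃ x k m y A B C)

onLine : (L : LineId) (i₁ i₂ i₃ j : Fin (length (line L))) →
         (lookup (line L) i₁ ≈ lookup (line L) j)
       × (lookup (line L) i₂ ≈ lookup (line L) j)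
       × (lookup (line L) i₃ ≈ lookup (line L) j)
onLine L i₁ i₂ i₃ j = same i₁ , same i₂ , same i₃
  where
  same : ∀ i → lookup (line L) i ≈ lookup (line L) j
  same i = ≈-ax (ax L (∈-lookup i) (∈-lookup j))

-- The three edges and the base select the line; the four numbers are the positions in it of
-- `rightᵇ`, `leftᵇ`, `leftᵃ` and `rightᵃ`.
threeLeaves-congruent : ∀ x k m y → AllCongruent x k m y (leaf _) (leaf _) (leaf _)
threeLeaves-congruent b b b b = onLine L1  0F 1F 2F 3F
threeLeaves-congruent b a b b = onLine L2  0F 1F 2F 3F
threeLeaves-congruent b a a b = onLine L3  0F 3F 1F 2F
threeLeaves-congruent b b a b = onLine L4  0F 3F 1F 2F
threeLeaves-congruent a b b b = onLine L5  1F 0F 2F 3F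
threeLeaves-congruent a a b b = onLine L6  1F 0F 2F 3F
threeLeaves-congruent a a a b = onLine L7  0F 3F 2F 1F
threeLeaves-congruent a b a b = onLine L8  0F 3F 2F 1F
threeLeaves-congruent b b b a = onLine L9  0F 1F 2F 3F
threeLeaves-congruent b a b a = onLine L10 0F 1F 2F 3F
threeLeaves-congruent b a a a = onLine L11 0F 3F 1F 2F
threeLeaves-congruent b b a a = onLine L12 0F 3F 1F 2F
threeLeaves-congruent a b b a = onLine L13 1F 0F 2F 3F
threeLeaves-congruent a a b a = onLine L14 1F 0F 2F 3F
threeLeaves-congruent a a a a = onLine L15 0F 3F 2F 1F
threeLeaves-congruent a b a a = onLine L16 0F 3F 2F 1F

-- Grafting the rightmost subtree first keeps the indices of the remaining
-- leaves at the literals 1 and 0.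
all-congruent : ∀ x k m y A B C → AllCongruent x k m y A B C
all-congruent x k m y A B C with threeLeaves-congruent x k m y
... | rb≈ra , lb≈ra , la≈ra =
    ≈-comp (left here) (left here) refl
      (≈-comp (right (left here)) (right (left here)) refl
        (≈-comp (right (right here)) (right (right here)) refl rb≈ra ≈-refl)
        ≈-refl)
      ≈-refl
  , ≈-comp (left (left here)) (left here) refl
      (≈-comp (left (right here)) (right (left here)) refl
        (≈-comp (right here) (right (right here)) refl lb≈ra ≈-refl)
        ≈-refl)
      ≈-refl
  , ≈-comp (left (left here)) (left here) refl
      (≈-comp (left (right here)) (right (left here)) refl
        (≈-comp (right here) (right (right here)) refl la≈ra ≈-refl)
        ≈-refl)
      ≈-refl

edge : Colour → AB
edge c1 = b
edge c2 = a

-- Only meaningful on words of length at least two.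
combWithBase : (y : AB) → List Colour → Tree (outAB y)
combWithBase y (u ∷ v ∷ [])       = Cor (g (edge u) y (edge v))
combWithBase y (u ∷ w@(_ ∷ _ ∷ _)) = node (g (edge u) y a) (leaf _) (combWithBase b w)
combWithBase y _                  = leaf _

comb : (c : Colour) → List Colour → Tree c
comb c1 = combWithBase a
comb c2 = combWithBase b

inAB-edge : ∀ u → inAB (edge u) ≡ u
inAB-edge c1 = refl
inAB-edge c2 = refl

leaves-combWithBase : ∀ y w → 2 ≤ length w → leaves (combWithBase y w) ≡ w
leaves-combWithBase y (u ∷ v ∷ []) _ =
  cong₂ (λ u′ v′ → u′ ∷ v′ ∷ []) (inAB-edge u) (inAB-edge v)
leaves-combWithBase y (u ∷ w@(_ ∷ _ ∷ _)) _ =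
  cong₂ _∷_ (inAB-edge u) (leaves-combWithBase b w (s≤s (s≤s z≤n)))
leaves-combWithBase y [] ()
leaves-combWithBase y (_ ∷ []) (s≤s ())

leaves-comb : ∀ c w → 2 ≤ length w → leaves (comb c w) ≡ w
leaves-comb c1 = leaves-combWithBase a
leaves-comb c2 = leaves-combWithBase b

Normalises : ∀ {c} → Tree c → Set
Normalises {c} t = t ≈ comb c (leaves t)

-- The fallback clause of `combWithBase` makes the comb on a one-letter word a unit.
leaf-normalises : ∀ c → Normalises (leaf c)
leaf-normalises c1 = ≈-refl
leaf-normalises c2 = ≈-refl

Cor-normalises : ∀ h → Normalises (Cor h)
Cor-normalises (g a a a) = ≈-refl
Cor-normalises (g a a b) = ≈-refl
Cor-normalises (g a b a) = ≈-refl
Cor-normalises (g a b b) = ≈-refl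
Cor-normalises (g b a a) = ≈-refl
Cor-normalises (g b a b) = ≈-refl
Cor-normalises (g b b a) = ≈-refl
Cor-normalises (g b b b) = ≈-refl

-- Generators are binary, so only a unit has a single leaf; it is the case in which `comb` has no
-- root node to recolour.
unitOrLonger : ∀ {c} (t : Tree c) →
               t ≡ leaf c ⊎ ∃[ u ] ∃[ v ] ∃[ w ] leaves t ≡ u ∷ v ∷ w
unitOrLonger (leaf c) = inj₁ refl
unitOrLonger (node h l r) with unitOrLonger l | unitOrLonger r
... | inj₁ refl | inj₁ refl = inj₂ (_ , _ , _ , refl)
... | inj₁ refl | inj₂ (_ , _ , _ , eq) rewrite eq = inj₂ (_ , _ , _ , refl)
... | inj₂ (_ , _ , _ , eq) | _ rewrite eq = inj₂ (_ , _ , _ , refl)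

-- Recolouring the middle edge alters the inner comb only in the base of its root, so what results
-- is still a comb.
middle-blue : ∀ x y z l u v w →
  node (g x y z) l (comb (inAB z) (u ∷ v ∷ w)) ≈ node (g x y a) l (combWithBase b (u ∷ v ∷ w))
middle-blue x y a l u v w = ≈-refl
middle-blue x y b l u v [] = proj₁ (all-congruent x (edge u) (edge v) y l _ _)
middle-blue x y b l u v (v′ ∷ w) = proj₁ (all-congruent x (edge u) a y l _ _)

comb-leaf : ∀ x y w {u v} →
  node (g x y a) (leaf (inAB x)) (combWithBase b (u ∷ v ∷ w)) ≡ comb (outAB y) (inAB x ∷ u ∷ v ∷ w)
comb-leaf a a w = refl
comb-leaf a b w = refl
comb-leaf b a w = refl
comb-leaf b b w = refl

leaf-node-normalises : ∀ x y z r → Normalises r → Normalises (node (g x y z) (leaf (inAB x)) r)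
leaf-node-normalises x y z r r≈ with unitOrLonger r
... | inj₁ refl = Cor-normalises (g x y z)
... | inj₂ (u , v , w , eq) rewrite eq =
  subst (_ ≈_) (comb-leaf x y w)
    (≈-trans (node-cong _ ≈-refl r≈) (middle-blue x y z (leaf _) u v w))

-- The equation e lets the recursion match on l, whose index is a colour of
-- the form inAB x.
node-normalises : ∀ {d} (l : Tree d) x y z (e : d ≡ inAB x) (r : Tree (inAB z)) →
                  Normalises r → Normalises (node (g x y z) (subst Tree e l) r)
node-normalises (leaf _) x y z refl r r≈ = leaf-node-normalises x y z r r≈
-- After the rotation, `l₂` is absorbed into `r` first, then `l₁`. Both calls descend into the left
-- subtree, so the right one may grow.
node-normalises (node (g x′ a z′) l₁ l₂) b y z refl r r≈
  rewrite ++-assoc (leaves l₁) (leaves l₂) (leaves r) =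
  let _ , lb≈ra , _ = all-congruent x′ z′ z y l₁ l₂ r in
  ≈-trans lb≈ra
    (node-normalises l₁ x′ y a refl _ (node-normalises l₂ z′ b z refl r r≈))
node-normalises (node (g x′ b z′) l₁ l₂) a y z refl r r≈
  rewrite ++-assoc (leaves l₁) (leaves l₂) (leaves r) =
  let _ , _ , la≈ra = all-congruent x′ z′ z y l₁ l₂ r in
  ≈-trans la≈ra
    (node-normalises l₁ x′ y a refl _ (node-normalises l₂ z′ b z refl r r≈))
-- A base and an edge with the same label carry different colours.
node-normalises (node (g x′ a z′) l₁ l₂) a y z ()
node-normalises (node (g x′ b z′) l₁ l₂) b y z ()

normalises : ∀ {c} (t : Tree c) → Normalises t
normalises (leaf c)               = leaf-normalises c
normalises (node (g x y z) l r) = node-normalises l x y z refl r (normalises r)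

leaves-determine : ∀ {c} (t t′ : Tree c) → leaves t ≡ leaves t′ → t ≈ t′
leaves-determine {c} t t′ eq =
  ≈-trans (subst (λ w → t ≈ comb c w) eq (normalises t)) (≈-sym (normalises t′))

evalFG-surjective : ∀ {c w} (x : Bulle c w) → Σ (FG c w) (λ s → evalFG s ≡ x)
evalFG-surjective x@(unit c)       = (leaf c , refl) , Bulle-irrelevant _ x
evalFG-surjective x@(bubble c w p) = (comb c w , leaves-comb c w p) , Bulle-irrelevant _ x

mainTheorem8 : (c : Colour) (w : List Colour) →
    ((s s' : FG c w) →
    (proj₁ s ≈ proj₁ s' → evalFG s ≡ evalFG s') × (evalFG s ≡ evalFG s' → proj₁ s ≈ proj₁ s'))
    × ((x : Bulle c w) → Σ (FG c w) (λ s → evalFG s ≡ x))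
mainTheorem8 c w = compare , evalFG-surjective
  where
  compare : (s s' : FG c w) →
    (proj₁ s ≈ proj₁ s' → evalFG s ≡ evalFG s') × (evalFG s ≡ evalFG s' → proj₁ s ≈ proj₁ s')
  -- Matching `refl` turns `w` into `leaves t`, so `eq` compares the leaves of the two trees.
  compare s@(t , refl) s'@(t′ , eq) =
    (λ _ → Bulle-irrelevant (evalFG s) (evalFG s')) , (λ _ → leaves-determine t t′ (sym eq))
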